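{- Let $\mathcal A\subseteq\mathbb N$ be such that for every $n_1\in\mathbb N$ it is decidable whether there exists $n_2\in\mathcal A$ with $n_1\le n_2$. Then for every environment $L$ and term $T$ it is decidable whether $L\vdash_{\mathcal A}T$.
   Context: Fix a nonempty set $\Sigma$ of sorts with decidable equality, a (computable) function $\mathrm{next}:\Sigma\to\Sigma$, and a countably infinite set of variables with decidable equality. Terms and environments: $T,U,V,W ::= \star s \mid x \mid \mathrm{app}(V,T) \mid \lambda x{:}W.\,T \mid \mathrm{def}(x{=}V).\,T \mid \mathrm{cast}(U,T)$ ($s\in\Sigma$) and $L,K ::= \emptyset \mid K,x{:}W \mid K,x{=}V$. $\mathrm{app}(V,T)$ applies $T$ to $V$; $\lambda x{:}W.\,T$ (de Bruijn's abstraction) and $\mathrm{def}(x{=}V).\,T$ (local definition) bind $x$ in $T$; $\mathrm{cast}(U,T)$ annotates $T$ with expected type $U$; entries $x{:}W$ and $x{=}V$ bind $x$. Terms are modulo renaming of bound variables, with bound variables distinct from each other and from free ones. Write $\mathsf{B}x[V]$ for either $\lambda x{:}V$ or $\mathrm{def}(x{=}V)$ and correspondingly $L,x[V]$ for $L,x{:}V$ resp. $L,x{=}V$. One step of bound rt-reduction $L\vdash T_1\to^nT_2$ is the smallest relation closed under: $L\vdash\mathrm{app}(V,\lambda x{:}W.\,T)\to^0\mathrm{def}(x{=}\mathrm{cast}(W,V)).\,T$; $K,x{=}V\vdash x\to^0V$; $L\vdash\mathrm{def}(x{=}V).\,T\to^0T$ if $x$ not free in $T$; $L\vdash\mathrm{app}(V,\mathrm{def}(x{=}W).\,T)\to^0\mathrm{def}(x{=}W).\,\mathrm{app}(V,T)$;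 $L\vdash\mathrm{cast}(U,T)\to^0T$; $L\vdash\star s\to^1\star\,\mathrm{next}(s)$; $K,x{:}W\vdash x\to^1W$; $L\vdash\mathrm{cast}(U,T)\to^1U$; if $K\vdash x\to^nT$, $y\neq x$, $y$ not free in $T$ then $K,y[V]\vdash x\to^nT$; if $L\vdash V_1\to^0V_2$ then $L\vdash\mathrm{app}(V_1,T)\to^0\mathrm{app}(V_2,T)$; if $L\vdash T_1\to^nT_2$ then $L\vdash\mathrm{app}(V,T_1)\to^n\mathrm{app}(V,T_2)$; if $L\vdash V_1\to^0V_2$ then $L\vdash\mathsf Bx[V_1].\,T\to^0\mathsf Bx[V_2].\,T$; if $L,x[V]\vdash T_1\to^nT_2$ then $L\vdash\mathsf Bx[V].\,T_1\to^n\mathsf Bx[V].\,T_2$; if $L\vdash U_1\to^0U_2$ then $L\vdash\mathrm{cast}(U_1,T)\to^0\mathrm{cast}(U_2,T)$; if $L\vdash T_1\to^0T_2$ then $L\vdash\mathrm{cast}(U,T_1)\to^0\mathrm{cast}(U,T_2)$; if $L\vdash U_1\to^1U_2$ and $L\vdash T_1\to^1T_2$ then $L\vdash\mathrm{cast}(U_1,T_1)\to^1\mathrm{cast}(U_2,T_2)$. $L\vdash T_1\to^{*n}T_2$ is the smallest relation with $L\vdash T\to^{*0}T$, containing single steps, and with $L\vdash T_1\to^{*n_1}T$, $L\vdash T\to^{*n_2}T_2$ implying $L\vdash T_1\to^{*n_1+n_2}T_2$. Validity $L\vdash_{\mathcal A}T$ is the smallest predicate closed under: $L\vdash_{\mathcal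 A}\star s$; if $K\vdash_{\mathcal A}V$ then $K,x[V]\vdash_{\mathcal A}x$; if $K\vdash_{\mathcal A}x$ and $y\neq x$ then $K,y[V]\vdash_{\mathcal A}x$; if $L\vdash_{\mathcal A}V$ and $L,x[V]\vdash_{\mathcal A}T$ then $L\vdash_{\mathcal A}\mathsf Bx[V].\,T$; if $L\vdash_{\mathcal A}U$, $L\vdash_{\mathcal A}T$ and some $U_0$ satisfies $L\vdash T\to^{*1}U_0$, $L\vdash U\to^{*0}U_0$, then $L\vdash_{\mathcal A}\mathrm{cast}(U,T)$; if $L\vdash_{\mathcal A}V$, $L\vdash_{\mathcal A}T$ and there are $n\in\mathcal A$, $x,W_0,U_0$ with $L\vdash T\to^{*n}\lambda x{:}W_0.\,U_0$ and $L\vdash V\to^{*1}W_0$, then $L\vdash_{\mathcal A}\mathrm{app}(V,T)$. -}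

module Defs where

open import Data.Nat using (ℕ; zero; suc; _+_; _<ᵇ_)
open import Data.Bool using (if_then_else_)
open import Data.Product using (∃; ∃-syntax; _×_; _,_)

-- Binders: abst = de Bruijn's abstraction λx:W, abbr = local definition def(x=V).
data Bind : Set where
  abst abbr : Bind

-- Terms over a set S of sorts, with variables as de Bruijn indices
-- (this represents terms modulo renaming of bound variables).
--   app V T  = app(V,T)   (T applied to V)
--   bind b W T = Bx[W].T   (x is index 0 in T)
--   cast U T = cast(U,T)
data Term (S : Set) : Set where
  sort : S → Term S
  lref : ℕ → Term S
  app  : Term S → Term S → Term S
  bind : Bind → Term S → Term S → Term S
  cast : Term S → Term S → Term S

-- Environments; ext K b V is  K,x[V]  (x:V if b = abst, x=V if b = abbr).
-- Index 0 refers to the most recent entry.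
data Env (S : Set) : Set where
  ∅   : Env S
  ext : Env S → Bind → Term S → Env S

liftAt : {S : Set} → ℕ → Term S → Term S
liftAt c (sort s)     = sort s
liftAt c (lref i)     = if i <ᵇ c then lref i else lref (suc i)
liftAt c (app V T)    = app (liftAt c V) (liftAt c T)
liftAt c (bind b W T) = bind b (liftAt c W) (liftAt (suc c) T)
liftAt c (cast U T)   = cast (liftAt c U) (liftAt c T)

lift1 : {S : Set} → Term S → Term S
lift1 = liftAt 0

module Reduction {S : Set} (next : S → S) where

  data Step : Env S → Term S → ℕ → Term S → Set where
    beta  : ∀ {L V W T} → Step L (app V (bind abst W T)) 0 (bind abbr (cast W V) T)
    delta : ∀ {K V} → Step (ext K abbr V) (lref 0) 0 (lift1 V)
    zeta  : ∀ {L V T} → Step L (bind abbr V (lift1 T)) 0 T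
    theta : ∀ {L V W T} → Step L (app V (bind abbr W T)) 0 (bind abbr W (app (lift1 V) T))
    eps   : ∀ {L U T} → Step L (cast U T) 0 T
    srt   : ∀ {L s} → Step L (sort s) 1 (sort (next s))
    ldec  : ∀ {K W} → Step (ext K abst W) (lref 0) 1 (lift1 W)
    ee    : ∀ {L U T} → Step L (cast U T) 1 U
    lref↑ : ∀ {K b V i n T} → Step K (lref i) n T → Step (ext K b V) (lref (suc i)) n (lift1 T)
    appV  : ∀ {L V₁ V₂ T} → Step L V₁ 0 V₂ → Step L (app V₁ T) 0 (app V₂ T)
    appT  : ∀ {L V T₁ T₂ n} → Step L T₁ n T₂ → Step L (app V T₁) n (app V T₂)
    bindV : ∀ {L b V₁ V₂ T} → Step L V₁ 0 V₂ → Step L (bind b V₁ T) 0 (bind b V₂ T)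
    bindT : ∀ {L b V T₁ T₂ n} → Step (ext L b V) T₁ n T₂ → Step L (bind b V T₁) n (bind b V T₂)
    castU : ∀ {L U₁ U₂ T} → Step L U₁ 0 U₂ → Step L (cast U₁ T) 0 (cast U₂ T)
    castT : ∀ {L U T₁ T₂} → Step L T₁ 0 T₂ → Step L (cast U T₁) 0 (cast U T₂)
    cast1 : ∀ {L U₁ U₂ T₁ T₂} → Step L U₁ 1 U₂ → Step L T₁ 1 T₂
          → Step L (cast U₁ T₁) 1 (cast U₂ T₂)

  data Steps : Env S → Term S → ℕ → Term S → Set where
    refl* : ∀ {L T} → Steps L T 0 T
    step* : ∀ {L T₁ n T₂} → Step L T₁ n T₂ → Steps L T₁ n T₂
    trans* : ∀ {L T₁ T T₂ n₁ n₂} → Steps L T₁ n₁ T → Steps L T n₂ T₂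
           → Steps L T₁ (n₁ + n₂) T₂

  data Valid (A : ℕ → Set) : Env S → Term S → Set where
    vsort : ∀ {L s} → Valid A L (sort s)
    vlref0 : ∀ {K b V} → Valid A K V → Valid A (ext K b V) (lref 0)
    vlrefS : ∀ {K b V i} → Valid A K (lref i) → Valid A (ext K b V) (lref (suc i))
    vbind : ∀ {L b V T} → Valid A L V → Valid A (ext L b V) T → Valid A L (bind b V T)
    vcast : ∀ {L U T} → Valid A L U → Valid A L T
          → (∃[ U₀ ] (Steps L T 1 U₀ × Steps L U 0 U₀))
          → Valid A L (cast U T)
    vapp  : ∀ {L V T} → Valid A L V → Valid A L T
          → (∃[ n ] ∃[ W₀ ] ∃[ U₀ ]
               (A n × Steps L T n (bind abst W₀ U₀) × Steps L V 1 W₀))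
          → Valid A L (app V T)

{-# OPTIONS --safe #-}
module Submission where

-- Every valid term has a simple arity, and arities are preserved by rt-steps of
-- any degree.  Following Gandy, a term of arity α is interpreted as a monotone
-- functional over ℕ, a declared variable x:W standing for a value that dominates
-- both W and the argument.  Every step strictly decreases this interpretation,
-- except the steps of degree 1 that only change sorts.  Hence the reducts of degree
-- 0 and 1 of a valid term form a finite, computable set, so the side condition of
-- cast is decided by search, without confluence.  For app the search is made up to
-- sorts, keeping the least degrees; larger degrees come for free, because the body
-- of an abstraction that has an arity always admits a further step of degree 1.

open import Defs
open import Data.Bool using (true; false; if_then_else_)
open import Data.Empty using (⊥-elim)
open import Data.List using (List; []; _∷_; _++_; map; concatMap)
open import Data.List.Relation.Unary.All using (All; []; _∷_)
open import Data.List.Membership.Propositional using (find; lose)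
open import Data.List.Relation.Unary.Any as Any using (Any; here; there)
import Data.List.Relation.Unary.Any.Properties as AnyP
open import Data.Maybe using (Maybe; just; nothing)
open import Data.Nat using (ℕ; zero; suc; _+_; _≤_; _<_; _∸_; z≤n; s≤s; _<ᵇ_)
open import Data.Nat.Properties
open import Data.Product using (Σ; ∃; _×_; _,_; proj₁; proj₂; ∃-syntax; map₂)
open import Data.Sum using (_⊎_; inj₁; inj₂)
open import Data.Unit using (⊤; tt)
open import Function using (_∘_; case_of_)
open import Relation.Binary.Construct.Closure.ReflexiveTransitive using (Star; ε; _◅_)
open import Induction.WellFounded using (Acc; acc)
open import Relation.Nullary using (Dec; yes; no)
open import Relation.Nullary.Decidable using (map′; _×-dec_)
open import Relation.Binary.Definitions using (DecidableEquality)
open import Relation.Binary.PropositionalEquality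
  using (_≡_; refl; sym; trans; cong; cong₂; subst)

-- Arities and hereditarily monotone functionals.

infixr 6 _⇒_
infix 4 _∋_∶_

data Arity : Set where
  ⋆   : Arity
  _⇒_ : Arity → Arity → Arity

private variable
  α β : Arity

mutual
  D : Arity → Set
  D ⋆       = ℕ
  D (α ⇒ β) = Σ (D α → D β) λ f → ∀ {x y} → Le α x y → Le β (f x) (f y)

  Le : ∀ α → D α → D α → Set
  Le ⋆       m n = m ≤ n
  Le (α ⇒ β) f g = ∀ x → Le β (proj₁ f x) (proj₁ g x)

-- Elements of `D` preserve `Le` but need not preserve `Lt`, since constant functionals are allowed.
-- The strictness lost in this way is restored by the offsets of `tick` and `both`.
Lt : ∀ α → D α → D α → Set
Lt ⋆       m n = m < n
Lt (α ⇒ β) f g = ∀ x → Lt β (proj₁ f x) (proj₁ g x)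

≼-refl : ∀ α {x} → Le α x x
≼-refl ⋆       = ≤-refl
≼-refl (α ⇒ β) = λ _ → ≼-refl β

≼-trans : ∀ α {x y z} → Le α x y → Le α y z → Le α x z
≼-trans ⋆       p q = ≤-trans p q
≼-trans (α ⇒ β) p q = λ x → ≼-trans β (p x) (q x)

≼-≺-trans : ∀ α {x y z} → Le α x y → Lt α y z → Lt α x z
≼-≺-trans ⋆       p q = ≤-<-trans p q
≼-≺-trans (α ⇒ β) p q = λ x → ≼-≺-trans β (p x) (q x)

≺⇒≼ : ∀ α {x y} → Lt α x y → Le α x y
≺⇒≼ ⋆       p = <⇒≤ p
≺⇒≼ (α ⇒ β) p = λ x → ≺⇒≼ β (p x)

-- The offset grows by one at each argument, so that adding it before an
-- application costs strictly more than adding it after: this orients theta.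
mutual
  plus : ∀ α → D α → ℕ → D α
  plus ⋆       m       k = m + k
  plus (α ⇒ β) (f , m) k =
    (λ x → plus β (f x) (suc k)) , λ p → plus-mono β (m p) ≤-refl

  plus-mono : ∀ α {x y k l} → Le α x y → k ≤ l → Le α (plus α x k) (plus α y l)
  plus-mono ⋆       p q = +-mono-≤ p q
  plus-mono (α ⇒ β) p q = λ x → plus-mono β (p x) (s≤s q)

plus-monoʳ-≺ : ∀ α {x y k l} → Le α x y → k < l → Lt α (plus α x k) (plus α y l)
plus-monoʳ-≺ ⋆       p q = +-mono-≤-< p q
plus-monoʳ-≺ (α ⇒ β) p q = λ x → plus-monoʳ-≺ β (p x) (s≤s q)

plus-monoˡ-≺ : ∀ α {x y k l} → Lt α x y → k ≤ l → Lt α (plus α x k) (plus α y l)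
plus-monoˡ-≺ ⋆       p q = +-mono-<-≤ p q
plus-monoˡ-≺ (α ⇒ β) p q = λ x → plus-monoˡ-≺ β (p x) (s≤s q)

plus-comm : ∀ α x k l → Le α (plus α (plus α x k) l) (plus α (plus α x l) k)
plus-comm ⋆       m k l = ≤-reflexive
  (trans (+-assoc m k l) (trans (cong (m +_) (+-comm k l)) (sym (+-assoc m l k))))
plus-comm (α ⇒ β) f k l = λ x → plus-comm β (proj₁ f x) (suc k) (suc l)

x≺x+suc : ∀ α x k → Lt α x (plus α x (suc k))
x≺x+suc ⋆       m k = m<m+n m (s≤s z≤n)
x≺x+suc (α ⇒ β) f k = λ x → x≺x+suc β (proj₁ f x) (suc k)

mutual
  add : ∀ α → D α → D α → D α
  add ⋆       m       n       = m + n
  add (α ⇒ β) (f , m) (g , n) =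
    (λ x → add β (f x) (g x)) , λ p → add-mono β (m p) (n p)

  add-mono : ∀ α {x y u v} → Le α x y → Le α u v → Le α (add α x u) (add α y v)
  add-mono ⋆       p q = +-mono-≤ p q
  add-mono (α ⇒ β) p q = λ x → add-mono β (p x) (q x)

add-monoˡ-≺ : ∀ α {x y u v} → Lt α x y → Le α u v → Lt α (add α x u) (add α y v)
add-monoˡ-≺ ⋆       p q = +-mono-<-≤ p q
add-monoˡ-≺ (α ⇒ β) p q = λ x → add-monoˡ-≺ β (p x) (q x)

add-monoʳ-≺ : ∀ α {x y u v} → Le α x y → Lt α u v → Lt α (add α x u) (add α y v)
add-monoʳ-≺ ⋆       p q = +-mono-≤-< p q
add-monoʳ-≺ (α ⇒ β) p q = λ x → add-monoʳ-≺ β (p x) (q x)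

x≼add : ∀ α x y → Le α x (add α x y)
x≼add ⋆       m n = m≤m+n m n
x≼add (α ⇒ β) f g = λ x → x≼add β (proj₁ f x) (proj₁ g x)

y≼add : ∀ α x y → Le α y (add α x y)
y≼add ⋆       m n = m≤n+m n m
y≼add (α ⇒ β) f g = λ x → y≼add β (proj₁ f x) (proj₁ g x)

least : ∀ α → D α
least ⋆       = 0
least (α ⇒ β) = (λ _ → least β) , λ _ → ≼-refl β

least≼ : ∀ α x → Le α (least α) x
least≼ ⋆       m = z≤n
least≼ (α ⇒ β) f = λ x → least≼ β (proj₁ f x)

-- Any fixed arguments would preserve `Lt`. With the least ones, the size of a functional is also at
-- most the size of each of its values.
size : ∀ α → D α → ℕ
size ⋆       m = m
size (α ⇒ β) f = size β (proj₁ f (least α))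

size-mono : ∀ α {x y} → Le α x y → size α x ≤ size α y
size-mono ⋆       p = p
size-mono (α ⇒ β) p = size-mono β (p (least α))

size-mono-< : ∀ α {x y} → Lt α x y → size α x < size α y
size-mono-< ⋆       p = p
size-mono-< (α ⇒ β) p = size-mono-< β (p (least α))

-- Charging the size of `v` makes a step inside `v` count even if `t` ignores it. The `suc` makes
-- removing the surrounding construct count as well.
tick : ∀ β α → D β → D α → D α
tick β α v t = plus α t (suc (size β v))

tick-mono : ∀ β α {v v′ t t′} → Le β v v′ → Le α t t′ → Le α (tick β α v t) (tick β α v′ t′)
tick-mono β α p q = plus-mono α q (s≤s (size-mono β p))

tick-monoˡ-≺ : ∀ β α {v v′ t t′} → Lt β v v′ → Le α t t′ → Lt α (tick β α v t) (tick β α v′ t′)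
tick-monoˡ-≺ β α p q = plus-monoʳ-≺ α q (s≤s (size-mono-< β p))

tick-monoʳ-≺ : ∀ β α {v v′ t t′} → Le β v v′ → Lt α t t′ → Lt α (tick β α v t) (tick β α v′ t′)
tick-monoʳ-≺ β α p q = plus-monoˡ-≺ α q (s≤s (size-mono β p))

-- This interprets `cast`, and hence also the value of a declared variable, because `beta` binds it
-- to a cast of the argument. The sum dominates both parts, and the final 1 makes `eps` and `ee`
-- strict.
both : ∀ α → D α → D α → D α
both α u t = plus α (add α u t) 1

both-mono : ∀ α {u u′ t t′} → Le α u u′ → Le α t t′ → Le α (both α u t) (both α u′ t′)
both-mono α p q = plus-mono α (add-mono α p q) ≤-refl

both-monoˡ-≺ : ∀ α {u u′ t t′} → Lt α u u′ → Le α t t′ → Lt α (both α u t) (both α u′ t′)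
both-monoˡ-≺ α p q = plus-monoˡ-≺ α (add-monoˡ-≺ α p q) ≤-refl

both-monoʳ-≺ : ∀ α {u u′ t t′} → Le α u u′ → Lt α t t′ → Lt α (both α u t) (both α u′ t′)
both-monoʳ-≺ α p q = plus-monoˡ-≺ α (add-monoʳ-≺ α p q) ≤-refl

u≺both : ∀ α u t → Lt α u (both α u t)
u≺both α u t = ≼-≺-trans α (x≼add α u t) (x≺x+suc α _ 0)

t≺both : ∀ α u t → Lt α t (both α u t)
t≺both α u t = ≼-≺-trans α (y≼add α u t) (x≺x+suc α _ 0)

-- Arity contexts, valuations and insertion of a slot.

-- An environment entry that has no arity occupies a slot `nothing`.
Ctx : Set
Ctx = List (Maybe Arity)

private variable
  Γ Γ′ : Ctx
  c i n : ℕ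

data _∋_∶_ : Ctx → ℕ → Arity → Set where
  Z : just α ∷ Γ ∋ 0 ∶ α
  S : ∀ {m} → Γ ∋ i ∶ α → m ∷ Γ ∋ suc i ∶ α

∋-unique : Γ ∋ i ∶ α → Γ ∋ i ∶ β → α ≡ β
∋-unique Z     Z     = refl
∋-unique (S x) (S y) = ∋-unique x y

Slot : Maybe Arity → Set
Slot nothing  = ⊤
Slot (just α) = D α

SlotLe : ∀ m → Slot m → Slot m → Set
SlotLe nothing  _ _ = ⊤
SlotLe (just α) x y = Le α x y

SlotLe-refl : ∀ m {x} → SlotLe m x x
SlotLe-refl nothing  = tt
SlotLe-refl (just α) = ≼-refl α

Vals : Ctx → Set
Vals = All Slot

data Vals≼ : Vals Γ → Vals Γ → Set where
  []  : Vals≼ [] []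
  _∷_ : ∀ {m x y} {ρ σ : Vals Γ} → SlotLe m x y → Vals≼ ρ σ → Vals≼ {m ∷ Γ} (x ∷ ρ) (y ∷ σ)

Vals≼-refl : (ρ : Vals Γ) → Vals≼ ρ ρ
Vals≼-refl []              = []
Vals≼-refl (_∷_ {m} x ρ) = SlotLe-refl m ∷ Vals≼-refl ρ

look : Γ ∋ i ∶ α → Vals Γ → D α
look Z     (x ∷ ρ) = x
look (S v) (_ ∷ ρ) = look v ρ

look-mono : (v : Γ ∋ i ∶ α) {ρ σ : Vals Γ} → Vals≼ ρ σ → Le α (look v ρ) (look v σ)
look-mono Z     (p ∷ _)  = p
look-mono (S v) (_ ∷ ps) = look-mono v ps

look-irrelevant : (v w : Γ ∋ i ∶ α) (ρ : Vals Γ) → look v ρ ≡ look w ρ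
look-irrelevant Z     Z     (_ ∷ _) = refl
look-irrelevant (S v) (S w) (_ ∷ ρ) = look-irrelevant v w ρ

data Insert : ℕ → Ctx → Ctx → Set where
  here  : ∀ {m} → Insert 0 Γ (m ∷ Γ)
  there : ∀ {m} → Insert c Γ Γ′ → Insert (suc c) (m ∷ Γ) (m ∷ Γ′)

remove : Insert c Γ Γ′ → Vals Γ′ → Vals Γ
remove here      (_ ∷ ρ) = ρ
remove (there ι) (x ∷ ρ) = x ∷ remove ι ρ

-- A recursive form of the comparison made by `liftAt`, which proofs by induction on `Insert` can
-- follow.
liftVar : ℕ → ℕ → ℕ
liftVar zero    i       = suc i
liftVar (suc c) zero    = zero
liftVar (suc c) (suc i) = suc (liftVar c i)

∋-lift : Insert c Γ Γ′ → Γ ∋ i ∶ α → Γ′ ∋ liftVar c i ∶ α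
∋-lift here      v     = S v
∋-lift (there ι) Z     = Z
∋-lift (there ι) (S v) = S (∋-lift ι v)

∋-unlift : ∀ i → Insert c Γ Γ′ → Γ′ ∋ liftVar c i ∶ α → Γ ∋ i ∶ α
∋-unlift i       here      (S v) = v
∋-unlift zero    (there ι) Z     = Z
∋-unlift (suc i) (there ι) (S v) = S (∋-unlift i ι v)

look-remove : (ι : Insert c Γ Γ′) (v : Γ ∋ i ∶ α) (w : Γ′ ∋ liftVar c i ∶ α) (ρ : Vals Γ′) →
              look v (remove ι ρ) ≡ look w ρ
look-remove here      v     (S w) (_ ∷ ρ) = look-irrelevant v w ρ
look-remove (there ι) Z     Z     (_ ∷ ρ) = refl
look-remove (there ι) (S v) (S w) (_ ∷ ρ) = look-remove ι v w ρ

-- Arity assignment and the interpretation of terms.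

module _ {S₀ : Set} where

  private variable
    T T′ U V W : Term S₀
    L : Env S₀

  liftAt-lref : ∀ c i → liftAt {S₀} c (lref i) ≡ lref (liftVar c i)
  liftAt-lref zero    i       = refl
  liftAt-lref (suc c) zero    = refl
  liftAt-lref (suc c) (suc i) with i <ᵇ c | liftAt-lref c i
  ... | true  | eq = cong lift1 eq
  ... | false | eq = cong lift1 eq

  infix 4 _⊢_∶_ _~_

  -- An arity forgets the difference between a term and its type: a declared variable has the arity
  -- of its type, and both parts of a cast share one. This is why steps of degree 1 can preserve it
  -- too.
  data _⊢_∶_ : Ctx → Term S₀ → Arity → Set where
    sort : ∀ {s} → Γ ⊢ sort s ∶ ⋆
    var  : Γ ∋ i ∶ α → Γ ⊢ lref i ∶ α
    app  : Γ ⊢ V ∶ β → Γ ⊢ T ∶ β ⇒ α → Γ ⊢ app V T ∶ α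
    lam  : Γ ⊢ W ∶ β → just β ∷ Γ ⊢ T ∶ α → Γ ⊢ bind abst W T ∶ β ⇒ α
    def  : Γ ⊢ V ∶ β → just β ∷ Γ ⊢ T ∶ α → Γ ⊢ bind abbr V T ∶ α
    cast : Γ ⊢ U ∶ α → Γ ⊢ T ∶ α → Γ ⊢ cast U T ∶ α

  arity-unique : Γ ⊢ T ∶ α → Γ ⊢ T ∶ β → α ≡ β
  arity-unique sort       sort       = refl
  arity-unique (var v)    (var w)    = ∋-unique v w
  arity-unique (app _ d)  (app _ e)  with refl ← arity-unique d e = refl
  arity-unique (lam c d)  (lam c′ e) with refl ← arity-unique c c′
                                     with refl ← arity-unique d e = refl
  arity-unique (def c d)  (def c′ e) with refl ← arity-unique c c′ = arity-unique d e
  arity-unique (cast _ d) (cast _ e) = arity-unique d e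

  ⊢-lift : Insert c Γ Γ′ → Γ ⊢ T ∶ α → Γ′ ⊢ liftAt c T ∶ α
  ⊢-lift ι sort = sort
  ⊢-lift {c = c} ι (var {i = i} v) rewrite liftAt-lref c i = var (∋-lift ι v)
  ⊢-lift ι (app d e)  = app (⊢-lift ι d) (⊢-lift ι e)
  ⊢-lift ι (lam d e)  = lam (⊢-lift ι d) (⊢-lift (there ι) e)
  ⊢-lift ι (def d e)  = def (⊢-lift ι d) (⊢-lift (there ι) e)
  ⊢-lift ι (cast d e) = cast (⊢-lift ι d) (⊢-lift ι e)

  ⊢-unlift : ∀ T → Insert c Γ Γ′ → Γ′ ⊢ liftAt c T ∶ α → Γ ⊢ T ∶ α
  ⊢-unlift (sort s) ι sort = sort
  ⊢-unlift {c = c} (lref i) ι d rewrite liftAt-lref c i with var v ← d = var (∋-unlift i ι v)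
  ⊢-unlift (app V T)       ι (app d e)  = app (⊢-unlift V ι d) (⊢-unlift T ι e)
  ⊢-unlift (bind abst V T) ι (lam d e)  = lam (⊢-unlift V ι d) (⊢-unlift T (there ι) e)
  ⊢-unlift (bind abbr V T) ι (def d e)  = def (⊢-unlift V ι d) (⊢-unlift T (there ι) e)
  ⊢-unlift (cast U T)      ι (cast d e) = cast (⊢-unlift U ι d) (⊢-unlift T ι e)

  mutual
    -- Each offset pays for a rule: the 1 at a variable for `delta` and `ldec`, the `tick` at `app`
    -- for `beta`, the `tick` at `def` for `zeta`. An abstraction applied to a value is evaluated
    -- exactly like the `def` that `beta` produces.
    ⟦_⟧ : Γ ⊢ T ∶ α → Vals Γ → D α
    ⟦ sort ⟧ ρ = 0
    ⟦ var v ⟧ ρ = plus _ (look v ρ) 1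
    ⟦ app {β = β} {α = α} d e ⟧ ρ = tick β α (⟦ d ⟧ ρ) (proj₁ (⟦ e ⟧ ρ) (⟦ d ⟧ ρ))
    ⟦ lam {β = β} {α = α} d e ⟧ ρ =
      (λ y → tick β α (both β (⟦ d ⟧ ρ) y) (⟦ e ⟧ (both β (⟦ d ⟧ ρ) y ∷ ρ))) ,
      λ p → tick-mono β α (both-mono β (≼-refl β) p)
              (⟦⟧-mono e (both-mono β (≼-refl β) p ∷ Vals≼-refl ρ))
    ⟦ def {β = β} {α = α} d e ⟧ ρ = tick β α (⟦ d ⟧ ρ) (⟦ e ⟧ (⟦ d ⟧ ρ ∷ ρ))
    ⟦ cast {α = α} d e ⟧ ρ = both α (⟦ d ⟧ ρ) (⟦ e ⟧ ρ)

    ⟦⟧-mono : (d : Γ ⊢ T ∶ α) {ρ σ : Vals Γ} → Vals≼ ρ σ → Le α (⟦ d ⟧ ρ) (⟦ d ⟧ σ)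
    ⟦⟧-mono sort ps = z≤n
    ⟦⟧-mono {α = α} (var v) ps = plus-mono α (look-mono v ps) ≤-refl
    ⟦⟧-mono {α = α} (app {β = β} d e) {ρ} {σ} ps =
      tick-mono β α (⟦⟧-mono d ps)
        (≼-trans α (⟦⟧-mono e ps _) (proj₂ (⟦ e ⟧ σ) (⟦⟧-mono d ps)))
    ⟦⟧-mono (lam {β = β} {α = α} d e) ps = λ y →
      let p = both-mono β (⟦⟧-mono d ps) (≼-refl β)
      in tick-mono β α p (⟦⟧-mono e (p ∷ ps))
    ⟦⟧-mono (def {β = β} {α = α} d e) ps =
      tick-mono β α (⟦⟧-mono d ps) (⟦⟧-mono e (⟦⟧-mono d ps ∷ ps))
    ⟦⟧-mono {α = α} (cast d e) ps = both-mono α (⟦⟧-mono d ps) (⟦⟧-mono e ps)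

  -- Two inequalities stand for an equation that would need extensionality. The derivation `e` is
  -- arbitrary because `zeta` starts from the lifted term; uniqueness of arities then aligns the
  -- inner derivations.
  ⟦⟧-lift : (ι : Insert c Γ Γ′) (d : Γ ⊢ T ∶ α) (e : Γ′ ⊢ liftAt c T ∶ α)
            {ρ : Vals Γ} {σ : Vals Γ′} → Vals≼ ρ (remove ι σ) → Vals≼ (remove ι σ) ρ →
            Le α (⟦ d ⟧ ρ) (⟦ e ⟧ σ) × Le α (⟦ e ⟧ σ) (⟦ d ⟧ ρ)
  ⟦⟧-lift ι sort sort ps qs = z≤n , z≤n
  ⟦⟧-lift {c = c} {α = α} ι (var {i = i} v) e {ρ} {σ} ps qs rewrite liftAt-lref c i
    with var w ← e =
      plus-mono α (subst (Le α (look v ρ)) (look-remove ι v w σ) (look-mono v ps)) ≤-refl ,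
      plus-mono α (subst (λ x → Le α x (look v ρ)) (look-remove ι v w σ) (look-mono v qs)) ≤-refl
  ⟦⟧-lift {α = α} ι (app {β = β} d₁ d₂) (app e₁ e₂) {ρ} {σ} ps qs
    with refl ← arity-unique (⊢-lift ι d₁) e₁ =
      let p₁ , q₁ = ⟦⟧-lift ι d₁ e₁ ps qs
          p₂ , q₂ = ⟦⟧-lift ι d₂ e₂ ps qs
      in tick-mono β α p₁ (≼-trans α (p₂ _) (proj₂ (⟦ e₂ ⟧ σ) p₁)) ,
         tick-mono β α q₁ (≼-trans α (q₂ _) (proj₂ (⟦ d₂ ⟧ ρ) q₁))
  ⟦⟧-lift ι (lam {β = β} {α = α} d₁ d₂) (lam e₁ e₂) ps qs =
      let p₁ , q₁ = ⟦⟧-lift ι d₁ e₁ ps qs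
          p y = both-mono β p₁ (≼-refl β {y})
          q y = both-mono β q₁ (≼-refl β {y})
      in (λ y → tick-mono β α (p y) (proj₁ (⟦⟧-lift (there ι) d₂ e₂ (p y ∷ ps) (q y ∷ qs)))) ,
         (λ y → tick-mono β α (q y) (proj₂ (⟦⟧-lift (there ι) d₂ e₂ (p y ∷ ps) (q y ∷ qs))))
  ⟦⟧-lift {α = α} ι (def {β = β} d₁ d₂) (def e₁ e₂) ps qs
    with refl ← arity-unique (⊢-lift ι d₁) e₁ =
      let p₁ , q₁ = ⟦⟧-lift ι d₁ e₁ ps qs
          p₂ , q₂ = ⟦⟧-lift (there ι) d₂ e₂ (p₁ ∷ ps) (q₁ ∷ qs)
      in tick-mono β α p₁ p₂ , tick-mono β α q₁ q₂
  ⟦⟧-lift {α = α} ι (cast d₁ d₂) (cast e₁ e₂) ps qs =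
      let p₁ , q₁ = ⟦⟧-lift ι d₁ e₁ ps qs
          p₂ , q₂ = ⟦⟧-lift ι d₂ e₂ ps qs
      in both-mono α p₁ p₂ , both-mono α q₁ q₂

  ⟦⟧-lift1-≼ : ∀ {m} (d : Γ ⊢ T ∶ α) (e : m ∷ Γ ⊢ lift1 T ∶ α) {x} ρ →
               Le α (⟦ e ⟧ (x ∷ ρ)) (⟦ d ⟧ ρ)
  ⟦⟧-lift1-≼ d e ρ = proj₂ (⟦⟧-lift here d e (Vals≼-refl ρ) (Vals≼-refl ρ))

  ⟦⟧-lift1-≽ : ∀ {m} (d : Γ ⊢ T ∶ α) (e : m ∷ Γ ⊢ lift1 T ∶ α) {x} ρ →
               Le α (⟦ d ⟧ ρ) (⟦ e ⟧ (x ∷ ρ))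
  ⟦⟧-lift1-≽ d e ρ = proj₁ (⟦⟧-lift here d e (Vals≼-refl ρ) (Vals≼-refl ρ))

  -- Environments and the valuations that model them.

  data Typed : Env S₀ → Ctx → Set where
    ∅    : Typed ∅ []
    bad  : ∀ {b} → Typed L Γ → Typed (ext L b V) (nothing ∷ Γ)
    good : ∀ {b} → Typed L Γ → Γ ⊢ V ∶ α → Typed (ext L b V) (just α ∷ Γ)

  -- Equality would be too strong: under an abstraction the variable takes the value `both`, which
  -- lies strictly above the declared type.
  Models : Typed L Γ → Vals Γ → Set
  Models ∅          _       = ⊤
  Models (bad e)    (_ ∷ ρ) = Models e ρ
  Models {Γ = just α ∷ _} (good e d) (x ∷ ρ) = Le α (⟦ d ⟧ ρ) x × Models e ρ

  tail : ∀ {b m} → Typed (ext L b V) (m ∷ Γ) → Typed L Γ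
  tail (bad e)    = e
  tail (good e _) = e

  Models-tail : ∀ {b m} (e : Typed (ext L b V) (m ∷ Γ)) {x ρ} →
                Models e (x ∷ ρ) → Models (tail e) ρ
  Models-tail (bad e)    m       = m
  Models-tail (good e _) (_ , m) = m

  model : (e : Typed L Γ) → ∃ (Models e)
  model ∅          = [] , tt
  model (bad e)    = let ρ , s = model e in tt ∷ ρ , s
  model (good {α = α} e d) = let ρ , s = model e in ⟦ d ⟧ ρ ∷ ρ , ≼-refl α , s

  -- Equality up to sorts.

  -- Sorts may differ only where a step of degree 1 can act. Arguments and the terms attached to
  -- binders take steps of degree 0 only and stay identical; in particular, related abstractions
  -- have the same domain.
  data _~_ : Term S₀ → Term S₀ → Set where
    sort : ∀ {s s′} → sort s ~ sort s′
    lref : lref i ~ lref i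
    app  : T ~ T′ → app V T ~ app V T′
    bind : ∀ {b} → T ~ T′ → bind b V T ~ bind b V T′
    cast : ∀ {U U′} → U ~ U′ → T ~ T′ → cast U T ~ cast U′ T′

  ~-refl : T ~ T
  ~-refl {sort _}     = sort
  ~-refl {lref _}     = lref
  ~-refl {app _ _}    = app ~-refl
  ~-refl {bind _ _ _} = bind ~-refl
  ~-refl {cast _ _}   = cast ~-refl ~-refl

  ~-sym : T ~ U → U ~ T
  ~-sym sort       = sort
  ~-sym lref       = lref
  ~-sym (app p)    = app (~-sym p)
  ~-sym (bind p)   = bind (~-sym p)
  ~-sym (cast p q) = cast (~-sym p) (~-sym q)

  ~-trans : T ~ U → U ~ V → T ~ V
  ~-trans sort       sort         = sort
  ~-trans lref       lref         = lref
  ~-trans (app p)    (app q)      = app (~-trans p q)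
  ~-trans (bind p)   (bind q)     = bind (~-trans p q)
  ~-trans (cast p q) (cast p′ q′) = cast (~-trans p p′) (~-trans q q′)

  -- Whether a variable occurs does not depend on sorts, so a `zeta` redex remains one under `~`.
  ~-unlift : ∀ T → liftAt c T ~ U → ∃ λ T′ → U ≡ liftAt c T′ × T ~ T′
  ~-unlift (sort _) (sort {s′ = s}) = sort s , refl , sort
  ~-unlift {c = c} (lref i) p with i <ᵇ c in eq
  ~-unlift {c = c} (lref i) lref | true  =
    lref i , cong (λ b → if b then lref i else lref (suc i)) (sym eq) , lref
  ~-unlift {c = c} (lref i) lref | false =
    lref i , cong (λ b → if b then lref i else lref (suc i)) (sym eq) , lref
  ~-unlift {c = c} (app V T) (app p) =
    let T′ , eq , q = ~-unlift T p in app V T′ , cong (app (liftAt c V)) eq , app q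
  ~-unlift {c = c} (bind b V T) (bind p) =
    let T′ , eq , q = ~-unlift T p in bind b V T′ , cong (bind b (liftAt c V)) eq , bind q
  ~-unlift (cast U T) (cast p q) =
    let U′ , eq , p′ = ~-unlift U p
        T′ , eq′ , q′ = ~-unlift T q
    in cast U′ T′ , cong₂ cast eq eq′ , cast p′ q′

-- Decrease of the interpretation along steps.

module _ {S₀ : Set} (next : S₀ → S₀) where

  open Reduction next

  private variable
    T T′ U V W : Term S₀
    L : Env S₀

  -- As `next` may have cycles, no measure can strictly decrease along every step on sorts. The weak
  -- inequality kept in that case is what `cast1` needs when only one of its two sides decreases
  -- strictly.
  Decrease : Typed L Γ → ℕ → Γ ⊢ T ∶ α → Γ ⊢ T′ ∶ α → Set
  Decrease {T = T} {α = α} {T′ = T′} e n d d′ =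
    (n ≡ 1 × T ~ T′ × (∀ ρ → Models e ρ → Le α (⟦ d′ ⟧ ρ) (⟦ d ⟧ ρ)))
    ⊎ (∀ ρ → Models e ρ → Lt α (⟦ d′ ⟧ ρ) (⟦ d ⟧ ρ))

  strict : {e : Typed L Γ} {d : Γ ⊢ T ∶ α} {d′ : Γ ⊢ T′ ∶ α} →
           Decrease e 0 d d′ → ∀ ρ → Models e ρ → Lt α (⟦ d′ ⟧ ρ) (⟦ d ⟧ ρ)
  strict (inj₂ f) = f

  -- The value of the variable dominates its entry by `Models`, and the 1 added at a variable makes
  -- this strict.
  unfold≺ : ∀ {b} (e : Typed L Γ) (d : Γ ⊢ V ∶ α) →
            Decrease (good {b = b} e d) n (var Z) (⊢-lift here d)
  unfold≺ {α = α} e d = inj₂ λ where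
    (x ∷ ρ) (p , _) → ≼-≺-trans α (≼-trans α (⟦⟧-lift1-≼ d (⊢-lift here d) ρ) p) (x≺x+suc α x 0)

  step-decreases : (e : Typed L Γ) → Step L T n T′ → (d : Γ ⊢ T ∶ α) →
                   Σ (Γ ⊢ T′ ∶ α) (Decrease e n d)
  step-decreases {α = α} e beta (app dV (lam dW dT)) =
    def (cast dW dV) dT , inj₂ λ ρ _ → x≺x+suc α _ _
  step-decreases (good e dV) delta (var Z) = ⊢-lift here dV , unfold≺ e dV
  step-decreases (good e dV) ldec (var Z) = ⊢-lift here dV , unfold≺ e dV
  step-decreases {α = α} e (zeta {T = T}) (def dV dT) =
    let d = ⊢-unlift T here dT
    in d , inj₂ λ ρ _ → ≼-≺-trans α (⟦⟧-lift1-≽ d dT ρ) (x≺x+suc α _ _)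
  step-decreases {α = α} e theta (app {β = γ} dV (def {β = β} dW dT)) =
    let dV′ = ⊢-lift here dV
    in def dW (app dV′ dT) , inj₂ λ ρ _ →
       let w = ⟦ dW ⟧ ρ
           t = ⟦ dT ⟧ (w ∷ ρ)
           p = ⟦⟧-lift1-≼ dV dV′ {w} ρ
       -- After the two offsets are exchanged, strictness comes from the offset of `W`: on the left
       -- it has passed through an application and has grown by one.
       in ≼-≺-trans α (tick-mono β α (≼-refl β) (tick-mono γ α p (proj₂ t p)))
          (≼-≺-trans α (plus-comm α _ _ _)
            (plus-monoˡ-≺ α (plus-monoʳ-≺ α (≼-refl α) ≤-refl) ≤-refl))
  step-decreases {α = α} e eps (cast dU dT) = dT , inj₂ λ ρ _ → t≺both α _ _
  step-decreases {α = α} e ee (cast dU dT) = dU , inj₂ λ ρ _ → u≺both α _ _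
  step-decreases e srt sort = sort , inj₁ (refl , sort , λ _ _ → z≤n)
  step-decreases {α = α} e (lref↑ s) (var (S v)) with step-decreases (tail e) s (var v)
  ... | d , inj₁ (refl , lref , f) = ⊢-lift here d , inj₁ (refl , lref , λ where
        (_ ∷ ρ) m → ≼-trans α (⟦⟧-lift1-≼ d (⊢-lift here d) ρ) (f ρ (Models-tail e m)))
  ... | d , inj₂ f = ⊢-lift here d , inj₂ λ where
        (_ ∷ ρ) m → ≼-≺-trans α (⟦⟧-lift1-≼ d (⊢-lift here d) ρ) (f ρ (Models-tail e m))
  step-decreases {α = α} e (appV s) (app {β = β} dV dT) =
    let dV′ , p = step-decreases e s dV
    in app dV′ dT , inj₂ λ ρ m →
       -- The function is only weakly monotone in its argument; the size charged by `tick` is what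
       -- decreases.
       tick-monoˡ-≺ β α (strict {e = e} {dV} {dV′} p ρ m)
         (proj₂ (⟦ dT ⟧ ρ) (≺⇒≼ β (strict {e = e} {dV} {dV′} p ρ m)))
  step-decreases {α = α} e (appT s) (app {β = β} dV dT) with step-decreases e s dT
  ... | d , inj₁ (p , q , f) = app dV d , inj₁ (p , app q , λ ρ m →
        tick-mono β α (≼-refl β) (f ρ m _))
  ... | d , inj₂ f = app dV d , inj₂ λ ρ m → tick-monoʳ-≺ β α (≼-refl β) (f ρ m _)
  step-decreases e (bindV s) (lam {β = β} {α = α} dV dT) =
    let dV′ , p = step-decreases e s dV
    in lam dV′ dT , inj₂ λ ρ m y →
       let q = both-monoˡ-≺ β (strict {e = e} {dV} {dV′} p ρ m) (≼-refl β {y})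
       in tick-monoˡ-≺ β α q (⟦⟧-mono dT (≺⇒≼ β q ∷ Vals≼-refl ρ))
  step-decreases {α = α} e (bindV s) (def {β = β} dV dT) =
    let dV′ , p = step-decreases e s dV
    in def dV′ dT , inj₂ λ ρ m →
       let q = strict {e = e} {dV} {dV′} p ρ m
       in tick-monoˡ-≺ β α q (⟦⟧-mono dT (≺⇒≼ β q ∷ Vals≼-refl ρ))
  step-decreases e (bindT s) (lam {β = β} {α = α} dV dT) with step-decreases (good e dV) s dT
  -- The body is evaluated at `both`, which dominates the declared type and so extends the model.
  ... | d , inj₁ (p , q , f) = lam dV d , inj₁ (p , bind q , λ ρ m y →
        tick-mono β α (≼-refl β) (f _ (≺⇒≼ β (u≺both β _ y) , m)))
  ... | d , inj₂ f = lam dV d , inj₂ λ ρ m y →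
        tick-monoʳ-≺ β α (≼-refl β) (f _ (≺⇒≼ β (u≺both β _ y) , m))
  step-decreases {α = α} e (bindT s) (def {β = β} dV dT) with step-decreases (good e dV) s dT
  ... | d , inj₁ (p , q , f) = def dV d , inj₁ (p , bind q , λ ρ m →
        tick-mono β α (≼-refl β) (f _ (≼-refl β , m)))
  ... | d , inj₂ f = def dV d , inj₂ λ ρ m →
        tick-monoʳ-≺ β α (≼-refl β) (f _ (≼-refl β , m))
  step-decreases {α = α} e (castU s) (cast dU dT) =
    let dU′ , p = step-decreases e s dU
    in cast dU′ dT , inj₂ λ ρ m →
       both-monoˡ-≺ α (strict {e = e} {dU} {dU′} p ρ m) (≼-refl α)
  step-decreases {α = α} e (castT s) (cast dU dT) =
    let dT′ , p = step-decreases e s dT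
    in cast dU dT′ , inj₂ λ ρ m →
       both-monoʳ-≺ α (≼-refl α) (strict {e = e} {dT} {dT′} p ρ m)
  step-decreases {α = α} e (cast1 s t) (cast dU dT) with step-decreases e s dU | step-decreases e t dT
  ... | d , inj₁ (_ , p , f) | d′ , inj₁ (_ , q , g) = cast d d′ ,
        inj₁ (refl , cast p q , λ ρ m → both-mono α (f ρ m) (g ρ m))
  ... | d , inj₂ f | d′ , inj₁ (_ , _ , g) = cast d d′ ,
        inj₂ λ ρ m → both-monoˡ-≺ α (f ρ m) (g ρ m)
  ... | d , inj₁ (_ , _ , f) | d′ , inj₂ g = cast d d′ ,
        inj₂ λ ρ m → both-monoʳ-≺ α (f ρ m) (g ρ m)
  ... | d , inj₂ f | d′ , inj₂ g = cast d d′ ,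
        inj₂ λ ρ m → both-monoˡ-≺ α (f ρ m) (≺⇒≼ α (g ρ m))

  -- No rule tests which sort it meets, and the parts that a rule copies or reduces at degree 0 are
  -- either identical on both sides or related again by `~`.
  simulate : T ~ U → Step L T n T′ → ∃ λ U′ → Step L U n U′ × T′ ~ U′
  simulate (app (bind p))   beta        = _ , beta , bind p
  simulate lref             delta       = _ , delta , ~-refl
  simulate (bind p)         (zeta {T = T}) with _ , refl , q ← ~-unlift T p = _ , zeta , q
  simulate (app (bind p))   theta       = _ , theta , bind (app p)
  simulate (cast p q)       eps         = _ , eps , q
  simulate sort             srt         = _ , srt , sort
  simulate lref             ldec        = _ , ldec , ~-refl
  simulate (cast p q)       ee          = _ , ee , p
  simulate lref             (lref↑ s)   = _ , lref↑ s , ~-refl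
  simulate (app p)          (appV s)    = _ , appV s , app p
  simulate (app p)          (appT s)    = let _ , t , q = simulate p s in _ , appT t , app q
  simulate (bind p)         (bindV s)   = _ , bindV s , bind p
  simulate (bind p)         (bindT s)   = let _ , t , q = simulate p s in _ , bindT t , bind q
  simulate (cast p q)       (castU s)   = let _ , t , p′ = simulate p s in _ , castU t , cast p′ q
  simulate (cast p q)       (castT s)   = let _ , t , q′ = simulate q s in _ , castT t , cast p q′
  simulate (cast p q)       (cast1 s t) =
    let _ , s′ , p′ = simulate p s
        _ , t′ , q′ = simulate q t
    in _ , cast1 s′ t′ , cast p′ q′

  -- Runs of steps and their degrees.

  infixr 5 _∷_

  -- The list form of `Steps`, which exposes the first step for induction.
  data Run (L : Env S₀) : Term S₀ → ℕ → Term S₀ → Set where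
    []  : Run L T 0 T
    _∷_ : ∀ {k} → Step L T k U → Run L U n V → Run L T (k + n) V

  Run-≡ : ∀ {m} → m ≡ n → Run L T m U → Run L T n U
  Run-≡ refl ss = ss

  Steps-≡ : ∀ {m} → m ≡ n → Steps L T m U → Steps L T n U
  Steps-≡ refl ss = ss

  _++ᵣ_ : ∀ {m} → Run L T m U → Run L U n V → Run L T (m + n) V
  []                   ++ᵣ ts = ts
  _∷_ {n = m} {k = k} s ss ++ᵣ ts = Run-≡ (sym (+-assoc k m _)) (s ∷ (ss ++ᵣ ts))

  run : Steps L T n U → Run L T n U
  run refl*        = []
  run (step* s)    = Run-≡ (+-identityʳ _) (s ∷ [])
  run (trans* s t) = run s ++ᵣ run t

  Step₀ : Env S₀ → Term S₀ → Term S₀ → Set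
  Step₀ L T U = Step L T 0 U

  Steps₀ : Env S₀ → Term S₀ → Term S₀ → Set
  Steps₀ L = Star (Step₀ L)

  Steps₀⇒Steps : Steps₀ L T U → Steps L T 0 U
  Steps₀⇒Steps ε        = refl*
  Steps₀⇒Steps (s ◅ ss) = trans* (step* s) (Steps₀⇒Steps ss)

  run-0 : Run L T n U → n ≡ 0 → Steps₀ L T U
  run-0 []                eq = ε
  run-0 (_∷_ {k = zero} s ss) eq = s ◅ run-0 ss eq

  Steps₁ : Env S₀ → Term S₀ → Term S₀ → Set
  Steps₁ L T V = ∃ λ U → Steps₀ L T U × ∃ λ U′ → Step L U 1 U′ × Steps₀ L U′ V

  -- Degrees add up, so exactly one step has degree 1 and all others have degree 0.
  run-1 : Run L T n U → n ≡ 1 → Steps₁ L T U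
  run-1 (_∷_ {k = zero} s ss) eq =
    let _ , t , ts = run-1 ss eq in _ , s ◅ t , ts
  run-1 (_∷_ {k = suc zero} s ss) eq = _ , ε , _ , s , run-0 ss (suc-injective eq)

  ⊢-steps : Typed L Γ → Steps L T n U → Γ ⊢ T ∶ α → Γ ⊢ U ∶ α
  ⊢-steps e refl*        d = d
  ⊢-steps e (step* s)    d = proj₁ (step-decreases e s d)
  ⊢-steps e (trans* s t) d = ⊢-steps e t (⊢-steps e s d)

  -- Raising the degree at which an abstraction is reached.

  appT* : Steps L T n U → Steps L (app V T) n (app V U)
  appT* refl*        = refl*
  appT* (step* s)    = step* (appT s)
  appT* (trans* s t) = trans* (appT* s) (appT* t)

  bindT* : ∀ {b} → Steps (ext L b V) T n U → Steps L (bind b V T) n (bind b V U)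
  bindT* refl*        = refl*
  bindT* (step* s)    = step* (bindT s)
  bindT* (trans* s t) = trans* (bindT* s) (bindT* t)

  lref-step : Typed L Γ → Γ ∋ i ∶ α → (∃ λ U → Step L (lref i) 0 U) ⊎ (∃ λ U → Step L (lref i) 1 U)
  lref-step (good {b = abst} e _) Z = inj₂ (_ , ldec)
  lref-step (good {b = abbr} e _) Z = inj₁ (_ , delta)
  lref-step {L = ext _ _ _} e (S v) with lref-step (tail e) v
  ... | inj₁ (_ , s) = inj₁ (_ , lref↑ s)
  ... | inj₂ (_ , s) = inj₂ (_ , lref↑ s)

  -- Induction on the measure rather than on the term: an lref bound to a
  -- definition first unfolds to a term that is not a subterm.
  progress : (e : Typed L Γ) (ρ : Vals Γ) → Models e ρ → ∀ N (d : Γ ⊢ T ∶ α) →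
             size α (⟦ d ⟧ ρ) < N → ∃ λ U → Steps L T 1 U
  progress e ρ m (suc N) sort lt = _ , step* srt
  progress {α = α} e ρ m (suc N) (var v) (s≤s le) with lref-step e v
  ... | inj₂ (_ , s) = _ , step* s
  ... | inj₁ (_ , s) =
        let d′ , p = step-decreases e s (var v)
            _ , t = progress e ρ m N d′
                      (<-≤-trans (size-mono-< α (strict {e = e} {var v} {d′} p ρ m)) le)
        in _ , trans* (step* s) t
  progress {α = α} e ρ m (suc N) (app {β = β} d d′) (s≤s le) =
    -- The size of the function is taken at the least argument, hence bounded by its value at the
    -- actual one.
    let q = ≼-≺-trans α (proj₂ (⟦ d′ ⟧ ρ) (least≼ β _)) (x≺x+suc α _ _)
        _ , t = progress e ρ m N d′ (<-≤-trans (size-mono-< α q) le)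
    in _ , appT* t
  progress e ρ m (suc N) (lam {β = β} {α = α} d d′) (s≤s le) =
    -- This is the value given to the variable when `size` evaluates the abstraction at `least`.
    let _ , t = progress (good e d) (both β (⟦ d ⟧ ρ) (least β) ∷ ρ)
                  (≺⇒≼ β (u≺both β _ _) , m) N d′
                  (<-≤-trans (size-mono-< α (x≺x+suc α _ _)) le)
    in _ , bindT* t
  progress {α = α} e ρ m (suc N) (def {β = β} d d′) (s≤s le) =
    let _ , t = progress (good e d) (⟦ d ⟧ ρ ∷ ρ) (≼-refl β , m) N d′
                  (<-≤-trans (size-mono-< α (x≺x+suc α _ _)) le)
    in _ , bindT* t
  progress e ρ m (suc N) (cast d d′) lt = _ , step* ee

  -- The body keeps an arity, so `progress` applies to it again and again, and steps inside the body
  -- leave the domain `W` unchanged.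
  abst-+ : Typed L Γ → Γ ⊢ T ∶ α → Steps L T n (bind abst W U) →
           ∀ k → ∃ λ U′ → Steps L T (n + k) (bind abst W U′)
  abst-+ {n = n} e d s zero = _ , Steps-≡ (sym (+-identityʳ n)) s
  abst-+ {n = n} e d s (suc k) with U′ , t ← abst-+ e d s k
    with lam dW dU ← ⊢-steps e t d =
    let e′ = good e dW
        ρ , m = model e′
        _ , u = progress e′ ρ m _ dU ≤-refl
    in _ , Steps-≡ (trans (+-comm (n + k) 1) (sym (+-suc n k)))
             (trans* t (bindT* u))

  abst-≤ : ∀ {m} → Typed L Γ → Γ ⊢ T ∶ α → Steps L T n (bind abst W U) → n ≤ m →
           ∃ λ U′ → Steps L T m (bind abst W U′)
  abst-≤ {n = n} {m = m} e d s le =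
    let U′ , t = abst-+ e d s (m ∸ n) in U′ , Steps-≡ (m+[n∸m]≡n le) t

-- Finite predicates and decision by search.

private variable
  X Y : Set

-- Only the first components are compared, because proofs of `P x` need not be unique.
Hit : {P : X → Set} → X → List (∃ P) → Set
Hit x = Any λ p → proj₁ p ≡ x

image : {P : X → Set} {Q : Y → Set} (f : X → Y) → (∀ {x} → P x → Q (f x)) → List (∃ P) → List (∃ Q)
image f g = map λ (x , p) → f x , g p

hit-image : {P : X → Set} {Q : Y → Set} (f : X → Y) (g : ∀ {x} → P x → Q (f x)) {x : X} {ps : List (∃ P)} →
            Hit x ps → Hit (f x) (image {P = P} {Q = Q} f g ps)
hit-image f g h = AnyP.map⁺ (Any.map (cong f) h)

record Finite {X : Set} (P : X → Set) : Set where
  field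
    elements : List (∃ P)
    complete : ∀ {x} → P x → Hit x elements

open Finite

⋃ : {P : X → Set} {R : X → Y → Set} → Finite P → (∀ {x} → P x → Finite (R x)) →
    Finite λ y → ∃ λ x → P x × R x y
⋃ {X = X} {P = P} {R = R} F G = record
  { elements = concatMap part (elements F)
  ; complete = λ (x , p , r) →
      -- The listed proof `p′` may differ from `p`; since `R` does not depend on it, `r` still fits.
      AnyP.concatMap⁺ part (Any.map (λ { {_ , p′} refl → hit-image _ _ (complete (G p′) r) }) (complete F p))
  }
  where
  part : ∃ P → List (∃ λ y → ∃ λ x → P x × R x y)
  part (x , p) = image (λ y → y) (λ r → x , p , r) (elements (G p))

Finite-⇔ : {P R : X → Set} → (∀ {x} → P x → R x) → (∀ {x} → R x → P x) → Finite P → Finite R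
Finite-⇔ f g F = record
  { elements = image (λ x → x) f (elements F)
  ; complete = λ r → hit-image _ _ (complete F (g r)) }

any-finite : {P R : X → Set} → Finite P → (∀ x → Dec (R x)) → Dec (∃ λ x → P x × R x)
any-finite {R = R} F R? = map′
  (λ (a : Any (R ∘ proj₁) (elements F)) → let (x , p) , r = Any.satisfied a in x , p , r)
  (λ (x , p , r) → Any.map (λ { refl → r }) (complete F p))
  (Any.any? (R? ∘ proj₁) (elements F))

member? : {P : X → Set} → DecidableEquality X → Finite P → ∀ x → Dec (P x)
member? {P = P} _≟_ F x = map′
  (λ (a : Hit x (elements F)) → let (_ , p) , eq = Any.satisfied a in subst P eq p)
  (complete F)
  (Any.any? (λ p → proj₁ p ≟ x) (elements F))

-- Inference of arities for terms and environments.

_≟ᵃ_ : DecidableEquality Arity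
⋆       ≟ᵃ ⋆       = yes refl
⋆       ≟ᵃ (_ ⇒ _) = no λ ()
(_ ⇒ _) ≟ᵃ ⋆       = no λ ()
(α ⇒ β) ≟ᵃ (γ ⇒ δ) =
  map′ (λ { (refl , refl) → refl }) (λ { refl → refl , refl }) (α ≟ᵃ γ ×-dec β ≟ᵃ δ)

_≟ᵇ_ : DecidableEquality Bind
abst ≟ᵇ abst = yes refl
abst ≟ᵇ abbr = no λ ()
abbr ≟ᵇ abst = no λ ()
abbr ≟ᵇ abbr = yes refl

slot? : ∀ Γ i → Dec (∃ (Γ ∋ i ∶_))
slot? []            i       = no λ ()
slot? (nothing ∷ Γ) zero    = no λ ()
slot? (just α ∷ Γ)  zero    = yes (α , Z)
slot? (m ∷ Γ)       (suc i) = map′ (map₂ S) (λ { (_ , S v) → _ , v }) (slot? Γ i)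

module _ {S₀ : Set} where

  private variable
    T V : Term S₀
    L : Env S₀

  infer : ∀ Γ (T : Term S₀) → Dec (∃ (Γ ⊢ T ∶_))
  infer Γ (sort s) = yes (⋆ , sort)
  infer Γ (lref i) = map′ (map₂ var) (λ { (_ , var v) → _ , v }) (slot? Γ i)
  infer Γ (app V T) with infer Γ V | infer Γ T
  ... | no ¬V       | _ = no λ { (_ , app d _) → ¬V (_ , d) }
  ... | yes _       | no ¬T = no λ { (_ , app _ d) → ¬T (_ , d) }
  ... | yes _       | yes (⋆ , d) = no λ { (_ , app _ d′) → case arity-unique d d′ of λ () }
  ... | yes (γ , d) | yes (β ⇒ α , d′) with γ ≟ᵃ β
  ...   | yes refl = yes (α , app d d′)
  ...   | no γ≢β = no λ { (_ , app e e′) →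
            case arity-unique d′ e′ of λ { refl → γ≢β (arity-unique d e) } }
  infer Γ (bind b V T) with infer Γ V
  ... | no ¬V = no λ { (_ , lam d _) → ¬V (_ , d) ; (_ , def d _) → ¬V (_ , d) }
  ... | yes (β , d) with infer (just β ∷ Γ) T
  ...   | no ¬T = no λ where
            (_ , lam e e′) → case arity-unique e d of λ { refl → ¬T (_ , e′) }
            (_ , def e e′) → case arity-unique e d of λ { refl → ¬T (_ , e′) }
  infer Γ (bind abst V T) | yes (β , d) | yes (α , d′) = yes (β ⇒ α , lam d d′)
  infer Γ (bind abbr V T) | yes (β , d) | yes (α , d′) = yes (α , def d d′)
  infer Γ (cast U T) with infer Γ U | infer Γ T
  ... | no ¬U       | _ = no λ { (_ , cast d _) → ¬U (_ , d) }
  ... | yes _       | no ¬T = no λ { (_ , cast _ d) → ¬T (_ , d) }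
  ... | yes (β , d) | yes (α , d′) with β ≟ᵃ α
  ...   | yes refl = yes (α , cast d d′)
  ...   | no β≢α = no λ { (_ , cast e e′) →
            β≢α (trans (arity-unique d e) (arity-unique e′ d′)) }

  slot : ∀ {Γ} → Dec (∃ (Γ ⊢ T ∶_)) → Maybe Arity
  slot (yes (α , _)) = just α
  slot (no _)        = nothing

  slot-just : ∀ {Γ} (r : Dec (∃ (Γ ⊢ T ∶_))) → Γ ⊢ T ∶ α → slot r ≡ just α
  slot-just (yes (_ , d)) e = cong just (arity-unique d e)
  slot-just (no ¬d)       e = ⊥-elim (¬d (_ , e))

  -- An entry without an arity is recorded, not rejected, because a term can be valid in an
  -- environment with invalid entries that it does not reach.
  ctx : Env S₀ → Ctx
  ctx ∅           = []
  ctx (ext L b V) = slot (infer (ctx L) V) ∷ ctx L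

  ctx-typed : ∀ L → Typed L (ctx L)
  ctx-typed ∅ = ∅
  ctx-typed (ext L b V) with infer (ctx L) V
  ... | yes (_ , d) = good (ctx-typed L) d
  ... | no _        = bad (ctx-typed L)

  -- Lowering as a left inverse of lifting.

  -- The removed index `c` itself gets a dummy value. Lifting never produces that index, so lifting
  -- the lowered term back reveals whether it occurred.
  lowerVar : ℕ → ℕ → ℕ
  lowerVar zero    zero    = zero
  lowerVar zero    (suc i) = i
  lowerVar (suc c) zero    = zero
  lowerVar (suc c) (suc i) = suc (lowerVar c i)

  lowerVar-liftVar : ∀ c i → lowerVar c (liftVar c i) ≡ i
  lowerVar-liftVar zero    i       = refl
  lowerVar-liftVar (suc c) zero    = refl
  lowerVar-liftVar (suc c) (suc i) = cong suc (lowerVar-liftVar c i)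

  lowerAt : ℕ → Term S₀ → Term S₀
  lowerAt c (sort s)     = sort s
  lowerAt c (lref i)     = lref (lowerVar c i)
  lowerAt c (app V T)    = app (lowerAt c V) (lowerAt c T)
  lowerAt c (bind b V T) = bind b (lowerAt c V) (lowerAt (suc c) T)
  lowerAt c (cast U T)   = cast (lowerAt c U) (lowerAt c T)

  lowerAt-liftAt : ∀ c T → lowerAt c (liftAt c T) ≡ T
  lowerAt-liftAt c (sort s)     = refl
  lowerAt-liftAt c (lref i)     rewrite liftAt-lref {S₀} c i = cong lref (lowerVar-liftVar c i)
  lowerAt-liftAt c (app V T)    = cong₂ app (lowerAt-liftAt c V) (lowerAt-liftAt c T)
  lowerAt-liftAt c (bind b V T) = cong₂ (bind b) (lowerAt-liftAt c V) (lowerAt-liftAt (suc c) T)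
  lowerAt-liftAt c (cast U T)   = cong₂ cast (lowerAt-liftAt c U) (lowerAt-liftAt c T)

-- Decidable equality of terms.

module _ {S₀ : Set} (_≟ˢ_ : DecidableEquality S₀) where

  _≟ᵗ_ : DecidableEquality (Term S₀)
  sort s ≟ᵗ sort s′ = map′ (λ { refl → refl }) (λ { refl → refl }) (s ≟ˢ s′)
  lref i ≟ᵗ lref j = map′ (λ { refl → refl }) (λ { refl → refl }) (i ≟ j)
  app V T ≟ᵗ app V′ T′ =
    map′ (λ { (refl , refl) → refl }) (λ { refl → refl , refl }) (V ≟ᵗ V′ ×-dec T ≟ᵗ T′)
  bind b V T ≟ᵗ bind b′ V′ T′ =
    map′ (λ { (refl , refl , refl) → refl }) (λ { refl → refl , refl , refl })
      (b ≟ᵇ b′ ×-dec V ≟ᵗ V′ ×-dec T ≟ᵗ T′)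
  cast U T ≟ᵗ cast U′ T′ =
    map′ (λ { (refl , refl) → refl }) (λ { refl → refl , refl }) (U ≟ᵗ U′ ×-dec T ≟ᵗ T′)
  sort _ ≟ᵗ lref _ = no λ ()
  sort _ ≟ᵗ app _ _ = no λ ()
  sort _ ≟ᵗ bind _ _ _ = no λ ()
  sort _ ≟ᵗ cast _ _ = no λ ()
  lref _ ≟ᵗ sort _ = no λ ()
  lref _ ≟ᵗ app _ _ = no λ ()
  lref _ ≟ᵗ bind _ _ _ = no λ ()
  lref _ ≟ᵗ cast _ _ = no λ ()
  app _ _ ≟ᵗ sort _ = no λ ()
  app _ _ ≟ᵗ lref _ = no λ ()
  app _ _ ≟ᵗ bind _ _ _ = no λ ()
  app _ _ ≟ᵗ cast _ _ = no λ ()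
  bind _ _ _ ≟ᵗ sort _ = no λ ()
  bind _ _ _ ≟ᵗ lref _ = no λ ()
  bind _ _ _ ≟ᵗ app _ _ = no λ ()
  bind _ _ _ ≟ᵗ cast _ _ = no λ ()
  cast _ _ ≟ᵗ sort _ = no λ ()
  cast _ _ ≟ᵗ lref _ = no λ ()
  cast _ _ ≟ᵗ app _ _ = no λ ()
  cast _ _ ≟ᵗ bind _ _ _ = no λ ()

-- Enumeration of one-step reducts.

module _ {S₀ : Set} (_≟ˢ_ : DecidableEquality S₀) (next : S₀ → S₀) where

  open Reduction next

  private variable
    T T′ U V W : Term S₀
    L : Env S₀

  Reduct : Env S₀ → Term S₀ → ℕ × Term S₀ → Set
  Reduct L T (n , U) = Step L T n U

  ofDegree : ∀ k → List (∃ (Reduct L T)) → List (∃ (Step L T k))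
  ofDegree k [] = []
  ofDegree k (((n , U) , s) ∷ xs) with n ≟ k
  ... | yes refl = (U , s) ∷ ofDegree k xs
  ... | no _     = ofDegree k xs

  hit-ofDegree : ∀ {k xs} → Hit {P = Reduct L T} (k , U) xs → Hit U (ofDegree k xs)
  hit-ofDegree {k = k} {((n , _) , _) ∷ _} h with n ≟ k | h
  ... | yes refl | here refl = here refl
  ... | yes refl | there h′  = there (hit-ofDegree h′)
  ... | no n≢k   | here refl = ⊥-elim (n≢k refl)
  ... | no _     | there h′  = hit-ofDegree h′

  headReducts : ∀ L V T → List (∃ (Reduct L (app V T)))
  headReducts L V (bind abst W T) = (_ , beta) ∷ []
  headReducts L V (bind abbr W T) = (_ , theta) ∷ []
  headReducts L V _               = []

  zetaReducts : ∀ L b V T → List (∃ (Reduct L (bind b V T)))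
  zetaReducts L abst V T = []
  -- The bound variable is absent from `T` exactly when lifting undoes lowering.
  zetaReducts L abbr V T with _≟ᵗ_ _≟ˢ_ (lift1 (lowerAt 0 T)) T
  ... | yes eq = (_ , subst (λ T′ → Step L (bind abbr V T′) 0 (lowerAt 0 T)) eq zeta) ∷ []
  ... | no _   = []

  castReducts : List (∃ (Step L U 1)) → List (∃ (Step L T 1)) → List (∃ (Reduct L (cast U T)))
  castReducts us ts = concatMap (λ (U′ , s) → image (λ T′ → 1 , cast U′ T′) (cast1 s) ts) us

  reducts : ∀ L T → List (∃ (Reduct L T))
  reducts L              (sort s)       = (_ , srt) ∷ []
  reducts ∅              (lref i)       = []
  reducts (ext L abst W) (lref zero)    = (_ , ldec) ∷ []
  reducts (ext L abbr V) (lref zero)    = (_ , delta) ∷ []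
  reducts (ext L b V)    (lref (suc i)) = image (map₂ lift1) lref↑ (reducts L (lref i))
  reducts L (app V T) =
    headReducts L V T ++
    image (λ V′ → 0 , app V′ T) appV (ofDegree 0 (reducts L V)) ++
    image (map₂ (app V)) appT (reducts L T)
  reducts L (bind b V T) =
    zetaReducts L b V T ++
    image (λ V′ → 0 , bind b V′ T) bindV (ofDegree 0 (reducts L V)) ++
    image (map₂ (bind b V)) bindT (reducts (ext L b V) T)
  reducts L (cast U T) =
    (_ , eps) ∷ (_ , ee) ∷
    image (λ U′ → 0 , cast U′ T) castU (ofDegree 0 (reducts L U)) ++
    image (λ T′ → 0 , cast U T′) castT (ofDegree 0 (reducts L T)) ++
    castReducts (ofDegree 1 (reducts L U)) (ofDegree 1 (reducts L T))

  hit-reducts : Step L T n U → Hit {P = Reduct L T} (n , U) (reducts L T)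
  hit-reducts beta  = here refl
  hit-reducts delta = here refl
  hit-reducts {L = L} (zeta {V = V} {T = T}) = AnyP.++⁺ˡ hit-zeta
    where
    hit-zeta : Hit (0 , T) (zetaReducts L abbr V (lift1 T))
    hit-zeta with _≟ᵗ_ _≟ˢ_ (lift1 (lowerAt 0 (lift1 T))) (lift1 T)
    ... | yes _ = here (cong (0 ,_) (lowerAt-liftAt 0 T))
    ... | no ne = ⊥-elim (ne (cong lift1 (lowerAt-liftAt 0 T)))
  hit-reducts theta = here refl
  hit-reducts eps   = here refl
  hit-reducts srt   = here refl
  hit-reducts ldec  = here refl
  hit-reducts ee    = there (here refl)
  hit-reducts (lref↑ {b = abst} s) = hit-image _ _ (hit-reducts s)
  hit-reducts (lref↑ {b = abbr} s) = hit-image _ _ (hit-reducts s)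
  hit-reducts {L = L} (appV {T = T} s) =
    AnyP.++⁺ʳ (headReducts L _ T) (AnyP.++⁺ˡ (hit-image _ _ (hit-ofDegree (hit-reducts s))))
  hit-reducts {L = L} (appT {V = V} {T₁ = T} s) =
    AnyP.++⁺ʳ (headReducts L V T)
      (AnyP.++⁺ʳ (image _ _ (ofDegree 0 (reducts L V))) (hit-image _ _ (hit-reducts s)))
  hit-reducts {L = L} (bindV {b = b} {V₁ = V} {T = T} s) =
    AnyP.++⁺ʳ (zetaReducts L b V T) (AnyP.++⁺ˡ (hit-image _ _ (hit-ofDegree (hit-reducts s))))
  hit-reducts {L = L} (bindT {b = b} {V = V} {T₁ = T} s) =
    AnyP.++⁺ʳ (zetaReducts L b V T)
      (AnyP.++⁺ʳ (image _ _ (ofDegree 0 (reducts L V))) (hit-image _ _ (hit-reducts s)))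
  hit-reducts (castU s) =
    there (there (AnyP.++⁺ˡ (hit-image _ _ (hit-ofDegree (hit-reducts s)))))
  hit-reducts {L = L} (castT {U = U} s) =
    there (there (AnyP.++⁺ʳ (image _ _ (ofDegree 0 (reducts L U)))
      (AnyP.++⁺ˡ (hit-image _ _ (hit-ofDegree (hit-reducts s))))))
  hit-reducts {L = L} (cast1 {U₁ = U} {T₁ = T} s t) =
    there (there (AnyP.++⁺ʳ (image _ _ (ofDegree 0 (reducts L U)))
      (AnyP.++⁺ʳ (image _ _ (ofDegree 0 (reducts L T)))
        (AnyP.concatMap⁺ _ (Any.map
          (λ { refl → hit-image _ _ (hit-ofDegree (hit-reducts t)) })
          (hit-ofDegree (hit-reducts s)))))))

  step-finite : ∀ L T k → Finite (Step L T k)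
  step-finite L T k = record
    { elements = ofDegree k (reducts L T)
    ; complete = λ s → hit-ofDegree (hit-reducts s) }

  -- Normalisation at degree 0 and finiteness of the reducts of degrees 0 and 1.

  Normalising : Env S₀ → Term S₀ → Set
  Normalising L = Acc (λ U T → Step₀ next L T U)

  measure : Typed L Γ → Γ ⊢ T ∶ α → ℕ
  measure {α = α} e d = size α (⟦ d ⟧ (proj₁ (model e)))

  normalising : (e : Typed L Γ) → ∀ N (d : Γ ⊢ T ∶ α) → measure e d < N → Normalising L T
  normalising {α = α} e (suc N) d (s≤s le) = acc λ s →
    let d′ , p = step-decreases next e s d
        ρ , m = model e
    in normalising e N d′
         (<-≤-trans (size-mono-< α (strict next {e = e} {d} {d′} p ρ m)) le)

  -- A constructive form of König's lemma: finite branching together with well-foundedness.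
  Steps₀-finite : Normalising L T → Finite (Steps₀ next L T)
  Steps₀-finite {L = L} {T = T} (acc rs) = record
    { elements = (T , ε) ∷ image (λ U → U) (λ (_ , s , ss) → s ◅ ss) (elements tails)
    ; complete = λ where
        ε        → here refl
        (s ◅ ss) → there (hit-image _ _ (complete tails (_ , s , ss)))
    }
    where
    tails : Finite λ U → ∃ λ T′ → Step L T 0 T′ × Steps₀ next L T′ U
    tails = ⋃ (step-finite L T 0) (λ s → Steps₀-finite (rs s))

  steps₀-finite : Typed L Γ → Γ ⊢ T ∶ α → Finite (λ U → Steps L T 0 U)
  steps₀-finite e d = Finite-⇔ (Steps₀⇒Steps next) (λ ss → run-0 next (run next ss) refl)
    (Steps₀-finite (normalising e _ d ≤-refl))

  -- The step of degree 1 need not decrease the measure, but it occurs once, and its target has an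
  -- arity, so the search at degree 0 can restart there.
  steps₁-finite : Typed L Γ → Γ ⊢ T ∶ α → Finite (λ U → Steps L T 1 U)
  steps₁-finite {L = L} e d =
    Finite-⇔ (λ (_ , s , _ , t , u) → trans* s (trans* (step* t) u))
      (λ ss → let _ , s , _ , t , u = run-1 next (run next ss) refl
              in _ , Steps₀⇒Steps next s , _ , t , Steps₀⇒Steps next u)
      (⋃ (steps₀-finite e d) λ s →
        let d′ = ⊢-steps next e s d in
        ⋃ (step-finite L _ 1) λ t →
          steps₀-finite e (proj₁ (step-decreases next e t d′)))

  -- Search up to sorts at all degrees.

  -- A step that does not decrease the measure only changes sorts, so it is
  -- skipped: the run that follows it can be simulated from its source at a
  -- smaller degree.
  mutual
    cover : (e : Typed L Γ) → ∀ N (d : Γ ⊢ T ∶ α) → measure e d < N →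
            List (∃ λ ((n , U) : ℕ × Term S₀) → Steps L T n U)
    cover {L = L} {T = T} e (suc N) d lt =
      (_ , refl*) ∷ concatMap (branch e N d lt) (reducts L T)

    branch : (e : Typed L Γ) → ∀ N (d : Γ ⊢ T ∶ α) → measure e d < suc N →
             ∃ (Reduct L T) → List (∃ λ ((n , U) : ℕ × Term S₀) → Steps L T n U)
    branch e N d lt (_ , s) = continue e N d lt s (step-decreases next e s d)

    continue : (e : Typed L Γ) → ∀ N (d : Γ ⊢ T ∶ α) → measure e d < suc N → Step L T n T′ →
               Σ (Γ ⊢ T′ ∶ α) (Decrease next e n d) →
               List (∃ λ ((n , U) : ℕ × Term S₀) → Steps L T n U)
    continue e N d lt s (d′ , inj₁ _) = []
    continue {α = α} {n = n} e N d (s≤s le) s (d′ , inj₂ f) =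
      let ρ , m = model e in
      image (λ (k , U) → n + k , U) (trans* (step* s))
        (cover e N d′ (<-≤-trans (size-mono-< α (f ρ m)) le))

  Covers : ℕ → Term S₀ → ∃ (λ ((n , U) : ℕ × Term S₀) → Steps L T n U) → Set
  Covers m V ((n , U) , _) = n ≤ m × U ~ V

  mutual
    -- By induction on the run. It starts from any `T′` related to `T` because, after a skipped
    -- step, the rest of the run starts from a term that agrees with `T` only up to sorts.
    cover-complete : (e : Typed L Γ) → ∀ N (d : Γ ⊢ T ∶ α) (lt : measure e d < N) →
                     T ~ T′ → Run next L T′ n V → Any (Covers n V) (cover e N d lt)
    cover-complete e (suc N) d lt q [] = here (z≤n , q)
    cover-complete e (suc N) d lt q (_∷_ {k = k} s ss)
      with _ , s₁ , q₁ ← simulate next (~-sym q) s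
      -- The list may hold another derivation of the same step; the decrease examined by the search
      -- is that of `s₂`.
      with (_ , s₂) , ∈reducts , refl ← find (hit-reducts s₁)
      with continue-complete e N d lt s₂ (step-decreases next e s₂ d) (~-sym q₁) ss
    -- The skipped step contributes its degree `k` to the run but not to the listed entry, hence the
    -- inequality in `Covers`.
    ... | inj₁ q₂ = Any.map (λ (le , r) → ≤-trans le (m≤n+m _ k) , r)
                      (cover-complete e (suc N) d lt (~-trans q₂ (~-sym q₁)) ss)
    ... | inj₂ h  = there (AnyP.concatMap⁺ (branch e N d lt) (lose ∈reducts h))

    continue-complete :
      ∀ {k} (e : Typed L Γ) → ∀ N (d : Γ ⊢ T ∶ α) (lt : measure e d < suc N) (s : Step L T k U)
      (r : Σ (Γ ⊢ U ∶ α) (Decrease next e k d)) → U ~ T′ → Run next L T′ n V →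
      T ~ U ⊎ Any (Covers (k + n) V) (continue e N d lt s r)
    continue-complete e N d lt s (d′ , inj₁ (_ , q , _)) _ _ = inj₁ q
    continue-complete {k = k} e N d (s≤s le) s (d′ , inj₂ f) q ss =
      inj₂ (AnyP.map⁺ (Any.map (λ (le , r) → +-monoʳ-≤ k le , r) (cover-complete e N d′ _ q ss)))

  -- Decision of validity.

  module _ (A : ℕ → Set) (above? : ∀ m → Dec (∃ λ n → A n × m ≤ n)) where

    Applicable : Env S₀ → Term S₀ → Term S₀ → Set
    Applicable L V T = ∃[ n ] ∃[ W ] ∃[ U ] (A n × Steps L T n (bind abst W U) × Steps L V 1 W)

    -- Since the degree of an abstraction can be raised, it suffices that `A` has some member at or
    -- above the listed degree, which is the question `above?` decides.
    Candidate : ∀ L V → ∃ (λ ((n , U) : ℕ × Term S₀) → Steps L T n U) → Set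
    Candidate L V ((n , U) , _) =
      ∃ λ W → (∃ λ U′ → U ≡ bind abst W U′) × Steps L V 1 W × ∃ λ m → A m × n ≤ m

    applicable? : Typed L Γ → Γ ⊢ V ∶ β → Γ ⊢ T ∶ α → Dec (Applicable L V T)
    applicable? {L = L} {V = V} {T = T} e d d′ = map′ to from (Any.any? candidate? candidates)
      where
      candidates = cover e _ d′ ≤-refl

      candidate? : ∀ p → Dec (Candidate {T = T} L V p)
      candidate? ((n , bind abst W U) , _) =
        map′ (λ { (s , m) → W , (U , refl) , s , m })
             (λ { (_ , (_ , refl) , s , m) → s , m })
             (member? (_≟ᵗ_ _≟ˢ_) (steps₁-finite e d) W ×-dec above? n)
      candidate? ((n , bind abbr _ _) , _) = no λ { (_ , (_ , ()) , _) }
      candidate? ((n , sort _) , _)        = no λ { (_ , (_ , ()) , _) }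
      candidate? ((n , lref _) , _)        = no λ { (_ , (_ , ()) , _) }
      candidate? ((n , app _ _) , _)       = no λ { (_ , (_ , ()) , _) }
      candidate? ((n , cast _ _) , _)      = no λ { (_ , (_ , ()) , _) }

      to : Any (Candidate L V) candidates → Applicable L V T
      to h with ((_ , _) , s) , W , (_ , refl) , t , m , Am , le ← Any.satisfied h =
        let U , s′ = abst-≤ next e d′ s le in m , W , U , Am , s′ , t

      from : Applicable L V T → Any (Candidate L V) candidates
      from (m , W , U , Am , s , t) =
        -- As `~` fixes the domain of an abstraction, the steps from `V` to `W` serve unchanged.
        Any.map (λ { (le , bind _) → W , (_ , refl) , t , m , Am , le })
          (cover-complete e _ d′ ≤-refl ~-refl (run next s))

    -- Steps of every degree preserve arities, and arities are unique. So the common reduct in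
    -- `vcast` equates the arities of its two parts, and the abstraction in `vapp` shows that the
    -- arity of `V` is the domain expected by `T`.
    valid-arity : Valid A L T → ∃ (ctx L ⊢ T ∶_)
    valid-arity vsort = _ , sort
    valid-arity (vlref0 {K = K} {V = V} v) with valid-arity v
    ... | α , d with infer (ctx K) V | slot-just (infer (ctx K) V) d
    ...   | yes _ | refl = α , var Z
    valid-arity (vlrefS v) with valid-arity v
    ... | α , var x = α , var (S x)
    valid-arity (vbind {L = L} {b = b} {V = V} v w) with valid-arity v
    ... | β , d with infer (ctx L) V | slot-just (infer (ctx L) V) d | valid-arity w
    valid-arity (vbind {b = abst} v w) | β , d | yes _ | refl | α , d′ = β ⇒ α , lam d d′
    valid-arity (vbind {b = abbr} v w) | β , d | yes _ | refl | α , d′ = α , def d d′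
    valid-arity (vcast {L = L} u v (_ , s , t)) =
      let e = ctx-typed L
          β , d  = valid-arity u
          α , d′ = valid-arity v
          eq = arity-unique (⊢-steps next e t d) (⊢-steps next e s d′)
      in α , cast (subst (ctx L ⊢ _ ∶_) eq d) d′
    valid-arity (vapp {L = L} v w (_ , _ , _ , _ , s , t)) with valid-arity v | valid-arity w
    ... | β , d | _ , d′ with ⊢-steps next (ctx-typed L) s d′
    ...   | lam {α = α} dW _ with refl ← arity-unique (⊢-steps next (ctx-typed L) t d) dW =
            α , app d d′

    -- Taking the decisions for variables as a parameter keeps this recursion structural in `T`,
    -- although the entry of a variable is not a subterm. `valid-lref?` supplies them by recursion
    -- on `L`.
    valid-in? : ∀ L → (∀ i → Dec (Valid A L (lref i))) → ∀ T → Dec (Valid A L T)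
    valid-in? L f (sort s) = yes vsort
    valid-in? L f (lref i) = f i
    valid-in? L f (app V T) with valid-in? L f V | valid-in? L f T
    ... | no ¬V | _     = no λ { (vapp v _ _) → ¬V v }
    ... | yes _ | no ¬T = no λ { (vapp _ v _) → ¬T v }
    ... | yes v | yes w =
      map′ (vapp v w) (λ { (vapp _ _ a) → a })
        (applicable? (ctx-typed L) (proj₂ (valid-arity v)) (proj₂ (valid-arity w)))
    valid-in? L f (bind b V T) with valid-in? L f V
    ... | no ¬V = no λ { (vbind v _) → ¬V v }
    ... | yes v = map′ (vbind v) (λ { (vbind _ w) → w }) (valid-in? (ext L b V) g T)
      where
      g : ∀ i → Dec (Valid A (ext L b V) (lref i))
      g zero    = yes (vlref0 v)
      g (suc i) = map′ vlrefS (λ { (vlrefS w) → w }) (f i)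
    valid-in? L f (cast U T) with valid-in? L f U | valid-in? L f T
    ... | no ¬U | _     = no λ { (vcast v _ _) → ¬U v }
    ... | yes _ | no ¬T = no λ { (vcast _ v _) → ¬T v }
    ... | yes v | yes w =
      map′ (vcast v w) (λ { (vcast _ _ a) → a })
        (any-finite (steps₁-finite e (proj₂ (valid-arity w)))
          (member? (_≟ᵗ_ _≟ˢ_) (steps₀-finite e (proj₂ (valid-arity v)))))
      where e = ctx-typed L

    valid-lref? : ∀ L i → Dec (Valid A L (lref i))
    valid-lref? ∅           i       = no λ ()
    valid-lref? (ext L b V) zero    =
      map′ vlref0 (λ { (vlref0 v) → v }) (valid-in? L (valid-lref? L) V)
    valid-lref? (ext L b V) (suc i) =
      map′ vlrefS (λ { (vlrefS v) → v }) (valid-lref? L i)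

theorem5p3 : {S : Set} → DecidableEquality S → S → (next : S → S)
    → (A : ℕ → Set)
    → ((n₁ : ℕ) → Dec (∃ λ n₂ → A n₂ × n₁ ≤ n₂))
    → (L : Env S) (T : Term S) → Dec (Reduction.Valid next A L T)
theorem5p3 _≟ˢ_ _ next A above? L =
  valid-in? _≟ˢ_ next A above? L (valid-lref? _≟ˢ_ next A above? L)
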